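{- For any tree $T$ with radius $r$ and any $n$-vertex graph $H$ with $E(H)\neq\emptyset$, $$\mathrm{gm}(T\cdot H)\leq 5 n^{1-1/2^r} \mathrm{tw}(H)^{1/2^r}.$$
   Context: For a graph $G$, $\mathrm{gm}(G)$ is the maximum integer $k$ such that the $k\times k$ grid is a minor of $G$, and $\mathrm{tw}(G)$ is the treewidth of $G$. $G_1\cdot G_2$ denotes the lexicographic product: vertex set $V(G_1)\times V(G_2)$, where distinct $(u_1,u_2),(v_1,v_2)$ are adjacent iff $u_1v_1\in E(G_1)$, or $u_1=v_1$ and $u_2v_2\in E(G_2)$. -}

module Defs where

open import Data.Nat using (ℕ; zero; suc; _+_; _*_; _≤_; _<_; ∣_-_∣)
open import Data.Nat.Properties using () renaming (_≟_ to _≟ℕ_)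
open import Data.Bool using (Bool; true; false; _∨_; _∧_)
open import Data.Fin using (Fin; zero; suc; toℕ; remQuot; inject₁; fromℕ) renaming (_≟_ to _≟F_)
open import Data.Product using (Σ; ∃; _×_; _,_; proj₁; proj₂)
open import Relation.Nullary using (¬_)
open import Relation.Nullary.Decidable using (⌊_⌋)
open import Relation.Binary.PropositionalEquality using (_≡_)
open import Function.Definitions using (Injective)

record Graph : Set where
  constructor mkGraph
  field
    n   : ℕ
    adj : Fin n → Fin n → Bool
open Graph public

record IsSimple (G : Graph) : Set where
  field
    symm  : ∀ u v → adj G u v ≡ adj G v u
    irrefl : ∀ v → adj G v v ≡ false

data WalkIn (G : Graph) (S : Fin (n G) → Bool) : Fin (n G) → Fin (n G) → ℕ → Set where
  here : ∀ {u} → S u ≡ true → WalkIn G S u u 0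
  step : ∀ {u w v l} → S u ≡ true → adj G u w ≡ true → WalkIn G S w v l → WalkIn G S u v (suc l)

allV : {m : ℕ} → Fin m → Bool
allV _ = true

Walk : (G : Graph) → Fin (n G) → Fin (n G) → ℕ → Set
Walk G = WalkIn G allV

Connected : Graph → Set
Connected G = ∀ u v → ∃ λ l → Walk G u v l

HasCycle : Graph → Set
HasCycle G = Σ ℕ λ k → Σ (Fin (suc (suc (suc k))) → Fin (n G)) λ c →
  Injective _≡_ _≡_ c
  × (∀ (i : Fin (suc (suc k))) → adj G (c (inject₁ i)) (c (suc i)) ≡ true)
  × adj G (c (fromℕ (suc (suc k)))) (c zero) ≡ true

record IsTree (T : Graph) : Set where
  field
    simple    : IsSimple T
    nonempty  : 1 ≤ n T
    connected : Connected T
    acyclic   : ¬ HasCycle T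

DistLe : (G : Graph) → Fin (n G) → Fin (n G) → ℕ → Set
DistLe G u v d = ∃ λ l → l ≤ d × Walk G u v l

IsRadius : Graph → ℕ → Set
IsRadius G r =
  (∃ λ c → ∀ u → DistLe G c u r)
  × (∀ v → ∃ λ u → ∀ d → DistLe G v u d → r ≤ d)

card : {m : ℕ} → (Fin m → Bool) → ℕ
card {zero} S = 0
card {suc m} S with S zero
... | true  = suc (card {m} (λ i → S (suc i)))
... | false = card {m} (λ i → S (suc i))

record TreeDecomp (G : Graph) (w : ℕ) : Set₁ where
  field
    tree      : Graph
    isTree    : IsTree tree
    bag       : Fin (n tree) → Fin (n G) → Bool
    coverV    : ∀ v → ∃ λ t → bag t v ≡ true
    coverE    : ∀ u v → adj G u v ≡ true → ∃ λ t → bag t u ≡ true × bag t v ≡ true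
    subtree   : ∀ v t t' → bag t v ≡ true → bag t' v ≡ true →
                ∃ λ l → WalkIn tree (λ s → bag s v) t t' l
    width     : ∀ t → card (bag t) ≤ suc w

IsTreewidth : Graph → ℕ → Set₁
IsTreewidth G k = TreeDecomp G k × (∀ j → TreeDecomp G j → k ≤ j)

record Minor (H G : Graph) : Set where
  field
    branch    : Fin (n H) → Fin (n G) → Bool
    nonempty  : ∀ a → ∃ λ v → branch a v ≡ true
    disjoint  : ∀ a b v → branch a v ≡ true → branch b v ≡ true → a ≡ b
    connected : ∀ a u v → branch a u ≡ true → branch a v ≡ true →
                ∃ λ l → WalkIn G (branch a) u v l
    edges     : ∀ a b → adj H a b ≡ true →
                ∃ λ u → ∃ λ v → branch a u ≡ true × branch b v ≡ true × adj G u v ≡ true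

Grid : ℕ → Graph
Grid k = mkGraph (k * k) λ x y → gadj (remQuot k x) (remQuot k y)
  where
  gadj : Fin k × Fin k → Fin k × Fin k → Bool
  gadj (i , j) (i' , j') =
    (⌊ i ≟F i' ⌋ ∧ ⌊ ∣ toℕ j - toℕ j' ∣ ≟ℕ 1 ⌋) ∨ (⌊ j ≟F j' ⌋ ∧ ⌊ ∣ toℕ i - toℕ i' ∣ ≟ℕ 1 ⌋)

IsGM : Graph → ℕ → Set
IsGM G g = Minor (Grid g) G × (∀ k → Minor (Grid k) G → k ≤ g)

Lex : Graph → Graph → Graph
Lex G₁ G₂ = mkGraph (n G₁ * n G₂) λ x y → ladj (remQuot (n G₂) x) (remQuot (n G₂) y)
  where
  ladj : Fin (n G₁) × Fin (n G₂) → Fin (n G₁) × Fin (n G₂) → Bool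
  ladj (u₁ , u₂) (v₁ , v₂) = adj G₁ u₁ v₁ ∨ (⌊ u₁ ≟F v₁ ⌋ ∧ adj G₂ u₂ v₂)

{-# OPTIONS --safe #-}
module Submission where

-- Root T at a centre of eccentricity r.  By downward induction on i, consider the rows and columns of
-- the grid which, inside a given window, only use vertices of depth at least i in T.  At i = r these all
-- lie over one vertex of T, and their crosses form a bramble in H, so there are at most tw(H) + 1 of them.
-- For i < r, the vertices of depth exactly i used in a window lie over one vertex of T, so there are at
-- most n of them.  Cut the window into f × f tiles with q rows and q columns each; a tile containing d of
-- these vertices keeps q - d rows and q - d columns of level i + 1, so q - d is at most the bound m for
-- that level.  Summing over the tiles gives f² q ≤ f² m + n, and optimising f gives
-- (s + 1)² ≤ 5 n (m + 1) for the bound s at level i.  When m ≥ n no f ≥ 1 is good enough, and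
-- s ≤ n is used instead: the fibres over the vertices of T separate T · H, so the same bramble argument
-- shows that T · H has no grid of order n + 1.

open import Defs
open import Data.Nat using (ℕ; zero; suc; _+_; _*_; _^_; _∸_; _≤_; _<_; z≤n; s≤s; _≤?_; _<?_; ∣_-_∣)
open import Data.Nat.DivMod using (_/_; _%_; m≡m%n+[m/n]*n; m%n<n; m/n*n≤m)
open import Data.Nat.Properties
open import Data.Nat.Solver using (module +-*-Solver)
open import Data.Bool using (Bool; true; false; _∧_; if_then_else_)
open import Data.Bool.Properties using (∨-zeroʳ) renaming (_≟_ to _≟B_)
open import Data.Empty using (⊥; ⊥-elim)
open import Data.Fin using (Fin; zero; suc; toℕ; fromℕ<; fromℕ; inject₁; remQuot; combine) renaming (_≟_ to _≟F_)
open import Data.Fin.Properties using (any?; toℕ-injective; toℕ<n; toℕ-fromℕ<; combine-remQuot; remQuot-combine)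
open import Data.List using (List; []; _∷_; _++_; length; lookup)
open import Data.List.Membership.Propositional using (_∈_)
open import Data.List.Membership.Propositional.Properties using (∈-lookup)
open import Data.List.Relation.Unary.All as All using (All; []; _∷_)
open import Data.List.Relation.Unary.All.Properties using (++⁺)
open import Data.List.Relation.Unary.AllPairs using ([]; _∷_)
open import Data.List.Relation.Unary.Any using (here; there)
open import Data.List.Relation.Unary.Unique.Propositional using (Unique)
open import Data.List.Relation.Unary.Unique.Propositional.Properties using () renaming (++⁺ to unique-++⁺)
open import Data.Product using (∃; _×_; _,_; proj₁; proj₂; swap)
open import Data.Sum using (_⊎_; inj₁; inj₂)
open import Function using (_∘_)
open import Relation.Nullary using (¬_; Dec; yes; no; does; contradiction)
open import Relation.Nullary.Decidable using (_×-dec_; ¬?; dec-true; isYes≗does)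
open import Relation.Binary.PropositionalEquality
open import Algebra.Properties.CommutativeSemigroup +-commutativeSemigroup using () renaming (interchange to +-interchange)
open import Algebra.Properties.CommutativeSemigroup *-commutativeSemigroup using () renaming (interchange to *-interchange)

-- Counting

does⇒ : {A : Set} (a? : Dec A) → does a? ≡ true → A
does⇒ (yes a) _ = a

size : ∀ {m} {P : Fin m → Set} → (∀ h → Dec (P h)) → ℕ
size P? = card (λ h → does (P? h))

card≤ : ∀ {m} (F : Fin m → Bool) → card F ≤ m
card≤ {zero} F = z≤n
card≤ {suc m} F with F zero
... | true  = s≤s (card≤ (F ∘ suc))
... | false = m≤n⇒m≤1+n (card≤ (F ∘ suc))

card-mono : ∀ {m} {F G : Fin m → Bool} → (∀ h → F h ≡ true → G h ≡ true) → card F ≤ card G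
card-mono {zero} F⊆G = z≤n
card-mono {suc m} {F} {G} F⊆G with F zero in eqF | G zero in eqG
... | true  | true  = s≤s (card-mono (F⊆G ∘ suc))
... | false | true  = m≤n⇒m≤1+n (card-mono (F⊆G ∘ suc))
... | false | false = card-mono (F⊆G ∘ suc)
... | true  | false = contradiction (trans (sym eqG) (F⊆G zero eqF)) λ ()

card-disjoint : ∀ {m} {F G H : Fin m → Bool} →
  (∀ h → F h ≡ true → H h ≡ true) → (∀ h → G h ≡ true → H h ≡ true) →
  (∀ h → F h ≡ true → G h ≡ true → ⊥) → card F + card G ≤ card H
card-disjoint {zero} F⊆H G⊆H F∩G = z≤n
card-disjoint {suc m} {F} {G} {H} F⊆H G⊆H F∩G
  with F zero in eqF | G zero in eqG | H zero in eqH
     | card-disjoint {m} (F⊆H ∘ suc) (G⊆H ∘ suc) (F∩G ∘ suc)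
... | true  | true  | _     | _  = ⊥-elim (F∩G zero eqF eqG)
... | true  | false | true  | ih = s≤s ih
... | false | true  | true  | ih = subst (_≤ suc (card (H ∘ suc))) (sym (+-suc _ _)) (s≤s ih)
... | false | false | true  | ih = m≤n⇒m≤1+n ih
... | false | false | false | ih = ih
... | true  | false | false | _  = contradiction (trans (sym eqH) (F⊆H zero eqF)) λ ()
... | false | true  | false | _  = contradiction (trans (sym eqH) (G⊆H zero eqG)) λ ()

card-pos : ∀ {m} {F : Fin m → Bool} h → F h ≡ true → 1 ≤ card F
card-pos {suc m} {F} h Fh with F zero in eqF
card-pos {suc m} {F} h       Fh | true  = s≤s z≤n
card-pos {suc m} {F} zero    Fh | false = contradiction (trans (sym eqF) Fh) λ ()
card-pos {suc m} {F} (suc h) Fh | false = card-pos h Fh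

card-two : ∀ {m} {F : Fin m → Bool} u v → u ≢ v → F u ≡ true → F v ≡ true → 2 ≤ card F
card-two {F = F} u v u≢v Fu Fv = ≤-trans
  (+-mono-≤ (card-pos {F = λ h → does (h ≟F u)} u (dec-true (u ≟F u) refl))
            (card-pos {F = λ h → does (h ≟F v)} v (dec-true (v ≟F v) refl)))
  (card-disjoint
    (λ h p → subst (λ h → F h ≡ true) (sym (does⇒ (h ≟F u) p)) Fu)
    (λ h p → subst (λ h → F h ≡ true) (sym (does⇒ (h ≟F v) p)) Fv)
    (λ h p q → u≢v (trans (sym (does⇒ (h ≟F u) p)) (does⇒ (h ≟F v) q))))

size-disjoint : ∀ {m} {P Q R : Fin m → Set}
  (P? : ∀ h → Dec (P h)) (Q? : ∀ h → Dec (Q h)) (R? : ∀ h → Dec (R h)) →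
  (∀ h → P h → R h) → (∀ h → Q h → R h) → (∀ h → P h → Q h → ⊥) →
  size P? + size Q? ≤ size R?
size-disjoint P? Q? R? P⊆R Q⊆R P∩Q = card-disjoint
  (λ h p → dec-true (R? h) (P⊆R h (does⇒ (P? h) p)))
  (λ h q → dec-true (R? h) (Q⊆R h (does⇒ (Q? h) q)))
  (λ h p q → P∩Q h (does⇒ (P? h) p) (does⇒ (Q? h) q))

size-mono : ∀ {m} {P Q : Fin m → Set} (P? : ∀ h → Dec (P h)) (Q? : ∀ h → Dec (Q h)) →
  (∀ h → P h → Q h) → size P? ≤ size Q?
size-mono P? Q? P⊆Q = card-mono (λ h p → dec-true (Q? h) (P⊆Q h (does⇒ (P? h) p)))

size-pos : ∀ {m} {P : Fin m → Set} (P? : ∀ h → Dec (P h)) h → P h → 1 ≤ size P?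
size-pos P? h p = card-pos h (dec-true (P? h) p)

bit : Bool → ℕ
bit b = if b then 1 else 0

count : (ℕ → Bool) → ℕ → ℕ → ℕ
count P a zero    = 0
count P a (suc k) = bit (P a) + count P (suc a) k

In : ℕ → ℕ → ℕ → Set
In a k x = a ≤ x × x < a + k

in? : ∀ a k x → Dec (In a k x)
in? a k x = (a ≤? x) ×-dec (x <? a + k)

in-left : ∀ {a k₁} k₂ {x} → In a k₁ x → In a (k₁ + k₂) x
in-left {a} {k₁} k₂ (a≤x , x<) = a≤x , <-≤-trans x< (+-monoʳ-≤ a (m≤m+n k₁ k₂))

in-right : ∀ {a k₂} k₁ {x} → In (a + k₁) k₂ x → In a (k₁ + k₂) x
in-right {a} {k₂} k₁ (≤x , x<) = ≤-trans (m≤m+n a k₁) ≤x , <-≤-trans x< (≤-reflexive (+-assoc a k₁ k₂))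

in-bounded : ∀ {a k x K} → In a k x → a + k ≤ K → x < K
in-bounded (_ , x<) ≤K = <-≤-trans x< ≤K

-- Scan from the left until `q` selected positions have been passed; the rest still holds `r`. Tiles
-- are thus cut by their number of selected rows or columns, whatever their length.
count-split : ∀ P q r a k → q + r ≤ count P a k →
  ∃ λ k₁ → ∃ λ k₂ → k ≡ k₁ + k₂ × q ≤ count P a k₁ × r ≤ count P (a + k₁) k₂
count-split P zero r a k le =
  0 , k , refl , z≤n , subst (λ a → r ≤ count P a k) (sym (+-identityʳ a)) le
count-split P (suc q) r a (suc k) le with P a in eq
... | true with k₁ , k₂ , refl , le₁ , le₂ ← count-split P q r (suc a) k (≤-pred le) =
  suc k₁ , k₂ , refl ,
  subst (λ b → suc q ≤ bit b + count P (suc a) k₁) (sym eq) (s≤s le₁) ,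
  subst (λ a → r ≤ count P a k₂) (sym (+-suc a k₁)) le₂
... | false with k₁ , k₂ , refl , le₁ , le₂ ← count-split P (suc q) r (suc a) k le =
  suc k₁ , k₂ , refl ,
  subst (λ b → suc q ≤ bit b + count P (suc a) k₁) (sym eq) le₁ ,
  subst (λ a → r ≤ count P a k₂) (sym (+-suc a k₁)) le₂

count-witness : ∀ P a k → 1 ≤ count P a k → ∃ λ x → In a k x × P x ≡ true
count-witness P a (suc k) le with P a in eq
... | true  = a , (≤-refl , m<m+n a (s≤s z≤n)) , eq
... | false with x , (<x , x<) , Px ← count-witness P (suc a) k le =
  x , (<⇒≤ <x , subst (x <_) (sym (+-suc a k)) x<) , Px

count-true : ∀ P a k → (∀ x → P x ≡ true) → k ≤ count P a k
count-true P a zero all = z≤n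
count-true P a (suc k) all rewrite all a = s≤s (count-true P (suc a) k all)

count≤ : ∀ P a k → count P a k ≤ k
count≤ P a zero = z≤n
count≤ P a (suc k) with P a
... | true  = s≤s (count≤ P (suc a) k)
... | false = m≤n⇒m≤1+n (count≤ P (suc a) k)

-- Grid models and windows

-- A grid minor given by the position of every vertex; the branch sets are the cells.
record GridModel {V : Set} (Adj : V → V → Set) (K : ℕ) : Set₁ where
  field
    row col : V → ℕ

  Cell : ℕ → ℕ → V → Set
  Cell x y z = row z ≡ x × col z ≡ y

  field
    cell-nonempty  : ∀ {x y} → x < K → y < K → ∃ (Cell x y)
    -- Connectedness is stated through invariants rather than walks, so that it composes along rows
    -- and columns by transitivity. The invariants used later are ancestors and components in a
    -- tree.
    cell-connected : ∀ {A : Set} (φ : V → A) {x y} → x < K → y < K →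
      (∀ {u v} → Cell x y u → Cell x y v → Adj u v → φ u ≡ φ v) →
      ∀ {u v} → Cell x y u → Cell x y v → φ u ≡ φ v
    row-step : ∀ {x y} → x < K → suc y < K →
      ∃ λ u → ∃ λ v → Cell x y u × Cell x (suc y) v × Adj u v
    col-step : ∀ {x y} → suc x < K → y < K →
      ∃ λ u → ∃ λ v → Cell x y u × Cell (suc x) y v × Adj u v

  Window : (a k c l : ℕ) → V → Set
  Window a k c l z = In a k (row z) × In c l (col z)

  window? : ∀ a k c l z → Dec (Window a k c l z)
  window? a k c l z = in? a k (row z) ×-dec in? c l (col z)

  Region : (a k c l : ℕ) (P Q : ℕ → Set) → V → Set
  Region a k c l P Q z = Window a k c l z × (P (row z) ⊎ Q (col z))

open GridModel

transpose : ∀ {V Adj K} → GridModel {V} Adj K → GridModel Adj K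
transpose M = record
  { row = col M
  ; col = row M
  ; cell-nonempty = λ x< y< → let z , c = cell-nonempty M y< x< in z , swap c
  ; cell-connected = λ φ x< y< inv cu cv → cell-connected M φ y< x<
      (λ cu cv → inv (swap cu) (swap cv)) (swap cu) (swap cv)
  ; row-step = λ x< y< → let u , v , cu , cv , uv = col-step M y< x<
                         in u , v , swap cu , swap cv , uv
  ; col-step = λ x< y< → let u , v , cu , cv , uv = row-step M y< x<
                         in u , v , swap cu , swap cv , uv
  }

module _ {V : Set} {Adj : V → V → Set} {K : ℕ} where

  row-connected : (M : GridModel Adj K) {A : Set} (φ : V → A) {x c l : ℕ} → x < K → c + l ≤ K →
    (∀ {u v} → row M u ≡ x → In c l (col M u) → row M v ≡ x → In c l (col M v) →
      Adj u v → φ u ≡ φ v) →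
    ∀ {u v} → row M u ≡ x → In c l (col M u) → row M v ≡ x → In c l (col M v) → φ u ≡ φ v
  row-connected M {A} φ {x} {c} {l} x< ≤K inv {u} {v} ru cu rv cv = ordered (≤-total (col M u) (col M v))
    where
    inside : ∀ {y u v} → In c l y → Cell M x y u → Cell M x y v → φ u ≡ φ v
    inside i = cell-connected M φ x< (in-bounded i ≤K)
      (λ { (r , refl) (r' , e) → inv r i r' (subst (In c l) (sym e) i) })
    along : ∀ j {y u v} → In c l y → In c l (y + j) → Cell M x y u → Cell M x (y + j) v → φ u ≡ φ v
    along zero {y} i i' cu cv = inside i cu (subst (λ y → Cell M x y _) (+-identityʳ y) cv)
    along (suc j) {y} {v = v} i i' cu cv =
      let i⁺ : In c l (suc y)
          i⁺ = m≤n⇒m≤1+n (proj₁ i) ,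
               ≤-<-trans (subst (suc y ≤_) (sym (+-suc y j)) (s≤s (m≤m+n y j))) (proj₂ i')
          p , q , cp , cq , pq = row-step M x< (in-bounded i⁺ ≤K)
      in trans (inside i cu cp) (trans
           (inv (proj₁ cp) (subst (In c l) (sym (proj₂ cp)) i)
                (proj₁ cq) (subst (In c l) (sym (proj₂ cq)) i⁺) pq)
           (along j i⁺ (subst (In c l) (+-suc y j) i') cq
                  (subst (λ y → Cell M x y v) (+-suc y j) cv)))
    ascending : ∀ {u v} → row M u ≡ x → In c l (col M u) → row M v ≡ x → In c l (col M v) →
      col M u ≤ col M v → φ u ≡ φ v
    ascending {u} {v} ru cu rv cv le =
      let e = sym (m+[n∸m]≡n le)
      in along (col M v ∸ col M u) cu (subst (In c l) e cv) (ru , refl) (rv , e)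
    ordered : col M u ≤ col M v ⊎ col M v ≤ col M u → φ u ≡ φ v
    ordered (inj₁ le) = ascending ru cu rv cv le
    ordered (inj₂ le) = sym (ascending rv cv ru cu le)

  -- A vertex in a selected row is linked along that row to column `y₀`, and along that column to
  -- the cell at `x₀`, `y₀`; a vertex in a selected column is linked symmetrically.
  region-connected : (M : GridModel Adj K) {A : Set} (φ : V → A) (P Q : ℕ → Set) {a k c l : ℕ} →
    a + k ≤ K → c + l ≤ K →
    (∃ λ x → In a k x × P x) → (∃ λ y → In c l y × Q y) →
    (∀ {u v} → Region M a k c l P Q u → Region M a k c l P Q v → Adj u v → φ u ≡ φ v) →
    ∀ {u v} → Region M a k c l P Q u → Region M a k c l P Q v → φ u ≡ φ v
  region-connected M {A} φ P Q {a} {k} {c} {l} a≤ c≤ (x₀ , ix₀ , Px₀) (y₀ , iy₀ , Qy₀) inv Ru Rv =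
    trans (to-centre Ru) (sym (to-centre Rv))
    where
    along-row : ∀ {x u v} → P x → In a k x → row M u ≡ x → In c l (col M u) →
      row M v ≡ x → In c l (col M v) → φ u ≡ φ v
    along-row Px ix = row-connected M φ (in-bounded ix a≤) c≤
      (λ { refl cu rv cv → inv ((ix , cu) , inj₁ Px)
           ((subst (In a k) (sym rv) ix , cv) , inj₁ (subst P (sym rv) Px)) })
    along-col : ∀ {y u v} → Q y → In c l y → col M u ≡ y → In a k (row M u) →
      col M v ≡ y → In a k (row M v) → φ u ≡ φ v
    along-col Qy iy = row-connected (transpose M) φ (in-bounded iy c≤) a≤
      (λ { refl ru cv rv → inv ((ru , iy) , inj₂ Qy)
           ((rv , subst (In c l) (sym cv) iy) , inj₂ (subst Q (sym cv) Qy)) })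
    centre : ∃ (Cell M x₀ y₀)
    centre = cell-nonempty M (in-bounded ix₀ a≤) (in-bounded iy₀ c≤)
    to-centre : ∀ {u} → Region M a k c l P Q u → φ u ≡ φ (proj₁ centre)
    to-centre ((ru , cu) , inj₁ Pu) =
      let z , rz , cz = cell-nonempty M (in-bounded ru a≤) (in-bounded iy₀ c≤)
          z₀ , r₀ , c₀ = centre
      in trans (along-row Pu ru refl cu rz (subst (In c l) (sym cz) iy₀))
               (along-col Qy₀ iy₀ cz (subst (In a k) (sym rz) ru) c₀ (subst (In a k) (sym r₀) ix₀))
    to-centre ((ru , cu) , inj₂ Qu) =
      let z , rz , cz = cell-nonempty M (in-bounded ix₀ a≤) (in-bounded cu c≤)
          z₀ , r₀ , c₀ = centre
      in trans (along-col Qu cu refl ru cz (subst (In a k) (sym rz) ix₀))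
               (along-row Px₀ ix₀ rz (subst (In c l) (sym cz) cu) r₀ (subst (In c l) (sym c₀) iy₀))

-- The deleted vertices are the `e h` with `S h` true, counted by their indices. Later they form
-- either a bag of a tree decomposition or a fibre of the product.
module Damage {V : Set} {Adj : V → V → Set} {K : ℕ} {m : ℕ} (e : Fin m → V) (S : Fin m → Bool) where

  Hit : GridModel Adj K → (c l x : ℕ) → Fin m → Set
  Hit M c l x h = S h ≡ true × row M (e h) ≡ x × In c l (col M (e h))

  hit? : ∀ M c l x h → Dec (Hit M c l x h)
  hit? M c l x h = (S h ≟B true) ×-dec (row M (e h) ≟ x) ×-dec in? c l (col M (e h))

  InWindow : GridModel Adj K → (a k c l : ℕ) → Fin m → Set
  InWindow M a k c l h = S h ≡ true × Window M a k c l (e h)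

  inWindow? : ∀ M a k c l h → Dec (InWindow M a k c l h)
  inWindow? M a k c l h = (S h ≟B true) ×-dec window? M a k c l (e h)

  hits : GridModel Adj K → (a k c l : ℕ) → ℕ
  hits M a k c l = size (inWindow? M a k c l)

  hits≤card : ∀ M a k c l → hits M a k c l ≤ card S
  hits≤card M a k c l = card-mono (λ h p → proj₁ (does⇒ (inWindow? M a k c l h) p))

  hits-transpose : ∀ M a k c l → hits (transpose M) c l a k ≤ hits M a k c l
  hits-transpose M a k c l = size-mono (inWindow? (transpose M) c l a k) (inWindow? M a k c l)
    (λ { h (s , i , j) → s , j , i })

  hits-rows : ∀ M a k₁ k₂ c l → hits M a k₁ c l + hits M (a + k₁) k₂ c l ≤ hits M a (k₁ + k₂) c l
  hits-rows M a k₁ k₂ c l = size-disjoint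
    (inWindow? M a k₁ c l) (inWindow? M (a + k₁) k₂ c l) (inWindow? M a (k₁ + k₂) c l)
    (λ { h (s , i , j) → s , in-left k₂ i , j })
    (λ { h (s , i , j) → s , in-right k₁ i , j })
    (λ { h (_ , (_ , x<) , _) (_ , (≤x , _) , _) → <⇒≱ x< ≤x })

  hits-cols : ∀ M a k c l₁ l₂ → hits M a k c l₁ + hits M a k (c + l₁) l₂ ≤ hits M a k c (l₁ + l₂)
  hits-cols M a k c l₁ l₂ = size-disjoint
    (inWindow? M a k c l₁) (inWindow? M a k (c + l₁) l₂) (inWindow? M a k c (l₁ + l₂))
    (λ { h (s , i , j) → s , i , in-left l₂ j })
    (λ { h (s , i , j) → s , i , in-right l₁ j })
    (λ { h (_ , _ , (_ , x<)) (_ , _ , (≤x , _)) → <⇒≱ x< ≤x })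

  undamaged : GridModel Adj K → (c l : ℕ) → (ℕ → Bool) → ℕ → Bool
  undamaged M c l P x = P x ∧ does (¬? (any? (hit? M c l x)))

  undamaged-elim : ∀ M c l P x → undamaged M c l P x ≡ true →
    P x ≡ true × (∀ h → ¬ Hit M c l x h)
  undamaged-elim M c l P x eq with P x
  ... | true = refl , λ h H → does⇒ (¬? (any? (hit? M c l x))) eq (h , H)

  -- A deleted vertex lies in at most one row, so it damages at most one.
  undamaged-count : ∀ M a k c l P →
    count P a k ≤ count (undamaged M c l P) a k + hits M a k c l
  undamaged-count M a zero c l P = z≤n
  undamaged-count M a (suc k) c l P = begin
    bit (P a) + count P (suc a) k
      ≤⟨ +-mono-≤ first (undamaged-count M (suc a) k c l P) ⟩
    (bit (U a) + hits M a 1 c l) + (count U (suc a) k + hits M (suc a) k c l)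
      ≡⟨ +-interchange (bit (U a)) (hits M a 1 c l) (count U (suc a) k) (hits M (suc a) k c l) ⟩
    (bit (U a) + count U (suc a) k) + (hits M a 1 c l + hits M (suc a) k c l)
      ≤⟨ +-monoʳ-≤ (bit (U a) + count U (suc a) k) rest ⟩
    (bit (U a) + count U (suc a) k) + hits M a (suc k) c l ∎
    where
    open ≤-Reasoning
    U = undamaged M c l P
    rest : hits M a 1 c l + hits M (suc a) k c l ≤ hits M a (suc k) c l
    rest = subst (λ b → hits M a 1 c l + hits M b k c l ≤ hits M a (suc k) c l)
      (+-comm a 1) (hits-rows M a 1 k c l)
    first : bit (P a) ≤ bit (U a) + hits M a 1 c l
    first with P a | any? (hit? M c l a)
    ... | false | _     = z≤n
    ... | true  | no _  = s≤s z≤n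
    ... | true  | yes (h , s , refl , j) =
      size-pos (inWindow? M a 1 c l) h (s , (≤-refl , m<m+n a (s≤s z≤n)) , j)

-- Tiling a window

True : (ℕ → Bool) → ℕ → Set
True P x = P x ≡ true

-- The rows selected by P and the columns selected by Q need to be Ok only inside the window.
Bounded : ∀ {V Adj K} → GridModel {V} Adj K → (V → Set) → ℕ → Set
Bounded {K = K} M Ok m = ∀ a k c l P Q → a + k ≤ K → c + l ≤ K →
  (∀ {z} → Region M a k c l (True P) (True Q) z → Ok z) →
  ∀ s → s ≤ count P a k → s ≤ count Q c l → s ≤ m

split-bound₁ : ∀ {a k₁ k₂ K} → a + (k₁ + k₂) ≤ K → a + k₁ ≤ K
split-bound₁ {a} {k₁} {k₂} = ≤-trans (+-monoʳ-≤ a (m≤m+n k₁ k₂))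

split-bound₂ : ∀ {a k₁ k₂ K} → a + (k₁ + k₂) ≤ K → (a + k₁) + k₂ ≤ K
split-bound₂ {a} {k₁} {k₂} = ≤-trans (≤-reflexive (+-assoc a k₁ k₂))

add-bounds : ∀ {x y W} u v w z → x ≤ u + w → y ≤ v + z → w + z ≤ W → x + y ≤ (u + v) + W
add-bounds {x} {y} {W} u v w z p q r = begin
  x + y             ≤⟨ +-mono-≤ p q ⟩
  (u + w) + (v + z) ≡⟨ +-interchange u w v z ⟩
  (u + v) + (w + z) ≤⟨ +-monoʳ-≤ (u + v) r ⟩
  (u + v) + W       ∎
  where open ≤-Reasoning

-- `survive` turns deletion into progress: an `Ok` vertex that is not deleted is `Ok'`, and a bound
-- `m` for `Ok'` is known already.
module Tiles {V : Set} {Adj : V → V → Set} {K N m q : ℕ} (M : GridModel Adj K)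
  (e : Fin N → V) (S : Fin N → Bool) (Ok Ok' : V → Set)
  (survive : ∀ {z} → Ok z → (∀ h → S h ≡ true → e h ≢ z) → Ok' z)
  (bounded : Bounded M Ok' m) where

  open Damage {V} {Adj} {K} e S

  -- With `d` deleted vertices in the tile, at least `q ∸ d` selected rows and `q ∸ d` selected
  -- columns are undamaged, hence `Ok'`, so `q ∸ d ≤ m`.
  tile : ∀ a k c l P Q → a + k ≤ K → c + l ≤ K →
    (∀ {z} → Region M a k c l (True P) (True Q) z → Ok z) →
    q ≤ count P a k → q ≤ count Q c l → q ≤ m + hits M a k c l
  tile a k c l P Q a≤ c≤ ok q≤P q≤Q = ≤-trans (m≤n+m∸n q (hits M a k c l))
    (≤-trans (+-monoʳ-≤ (hits M a k c l) (bounded a k c l U U' a≤ c≤ ok' (q ∸ hits M a k c l)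
      (∸-≤ q≤P (undamaged-count M a k c l P))
      (∸-≤ q≤Q (≤-trans (undamaged-count (transpose M) c l a k Q)
        (+-monoʳ-≤ (count U' c l) (hits-transpose M a k c l))))))
    (≤-reflexive (+-comm (hits M a k c l) m)))
    where
    U = undamaged M c l P
    U' = undamaged (transpose M) a k Q
    ∸-≤ : ∀ {x y} → q ≤ x → x ≤ y + hits M a k c l → q ∸ hits M a k c l ≤ y
    ∸-≤ {y = y} q≤x x≤ = m≤n+o⇒m∸n≤o q (hits M a k c l)
      (subst (q ≤_) (+-comm y _) (≤-trans q≤x x≤))
    ok' : ∀ {z} → Region M a k c l (True U) (True U') z → Ok' z
    ok' {z} ((i , j) , inj₁ u) with Pz , ¬hit ← undamaged-elim M c l P (row M z) u =
      survive (ok ((i , j) , inj₁ Pz)) λ { h Sh refl → ¬hit h (Sh , refl , j) }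
    ok' {z} ((i , j) , inj₂ u) with Qz , ¬hit ← undamaged-elim (transpose M) a k Q (col M z) u =
      survive (ok ((i , j) , inj₂ Qz)) λ { h Sh refl → ¬hit h (Sh , refl , i) }

  tile-row : ∀ f a k c l P Q → a + k ≤ K → c + l ≤ K →
    (∀ {z} → Region M a k c l (True P) (True Q) z → Ok z) →
    q ≤ count P a k → f * q ≤ count Q c l → f * q ≤ f * m + hits M a k c l
  tile-row zero a k c l P Q a≤ c≤ ok q≤P fq≤Q = z≤n
  tile-row (suc f) a k c l P Q a≤ c≤ ok q≤P fq≤Q
    with l₁ , l₂ , refl , le₁ , le₂ ← count-split Q q (f * q) c l fq≤Q =
    add-bounds m (f * m) (hits M a k c l₁) (hits M a k (c + l₁) l₂)
      (tile a k c l₁ P Q a≤ (split-bound₁ {c} c≤) (λ { ((i , j) , r) → ok ((i , in-left l₂ j) , r) }) q≤P le₁)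
      (tile-row f a k (c + l₁) l₂ P Q a≤ (split-bound₂ {c} c≤) (λ { ((i , j) , r) → ok ((i , in-right l₁ j) , r) }) q≤P le₂)
      (hits-cols M a k c l₁ l₂)

  -- The tiles are disjoint, so their deleted vertices together number at most those of the window.
  -- Keeping `g` apart from `f` lets the induction peel off one strip of rows at a time.
  tiling : ∀ f g a k c l P Q → a + k ≤ K → c + l ≤ K →
    (∀ {z} → Region M a k c l (True P) (True Q) z → Ok z) →
    f * q ≤ count P a k → g * q ≤ count Q c l → f * (g * q) ≤ f * (g * m) + hits M a k c l
  tiling zero g a k c l P Q a≤ c≤ ok fq≤P gq≤Q = z≤n
  tiling (suc f) g a k c l P Q a≤ c≤ ok fq≤P gq≤Q
    with k₁ , k₂ , refl , le₁ , le₂ ← count-split P q (f * q) a k fq≤P =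
    add-bounds (g * m) (f * (g * m)) (hits M a k₁ c l) (hits M (a + k₁) k₂ c l)
      (tile-row g a k₁ c l P Q (split-bound₁ {a} a≤) c≤ (λ { ((i , j) , r) → ok ((in-left k₂ i , j) , r) }) le₁ gq≤Q)
      (tiling f g (a + k₁) k₂ c l P Q (split-bound₂ {a} a≤) c≤ (λ { ((i , j) , r) → ok ((in-right k₁ i , j) , r) }) le₂ gq≤Q)
      (hits-rows M a k₁ k₂ c l)

-- Arithmetic

threshold : {P : ℕ → Set} → (∀ x → Dec (P x)) → ∀ a k → P a → ¬ P (a + k) →
  ∃ λ x → a ≤ x × P x × ¬ P (suc x)
threshold {P} P? a zero Pa ¬P = contradiction (subst P (sym (+-identityʳ a)) Pa) ¬P
threshold {P} P? a (suc k) Pa ¬P with P? (suc a)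
... | no ¬Psa = a , ≤-refl , Pa , ¬Psa
... | yes Psa with x , <x , Px , ¬Psx ← threshold P? (suc a) k Psa (λ p → ¬P (subst P (sym (+-suc a k)) p)) =
  x , <⇒≤ <x , Px , ¬Psx

square-root : ∀ b → 1 ≤ b → ∃ λ x → suc x * suc x ≤ b × b < suc (suc x) * suc (suc x)
-- The scan ends by `suc b`, whose square exceeds `b`.
square-root b 1≤b with threshold (λ x → x * x ≤? b) 1 b 1≤b (<⇒≱ (m≤m*n (suc b) (suc b)))
... | suc x , _ , le , ¬le = x , le , ≰⇒> ¬le

-- (5n − 2a)(2a − n) ≥ 0
square-of-sum : ∀ a n → 2 * a ≤ 5 * n → n ≤ 2 * a → (a + n) * (a + n) ≤ 5 * (a * n)
square-of-sum a n 2a≤5n n≤2a = *-cancelˡ-≤ 4 (begin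
  4 * ((a + n) * (a + n))                  ≤⟨ m≤m+n _ (n * n + x * y) ⟩
  4 * ((a + n) * (a + n)) + (n * n + x * y)
    ≡⟨ solve 4 (λ a n x y → con 4 :* ((a :+ n) :* (a :+ n)) :+ (n :* n :+ x :* y)
         := (con 2 :* a) :* (con 2 :* a) :+ (con 5 :* n) :* n :+ x :* y :+ con 8 :* a :* n) refl a n x y ⟩
  (2 * a) * (2 * a) + (5 * n) * n + x * y + 8 * a * n
    ≡⟨ cong₂ (λ u v → (2 * a) * u + v * n + x * y + 8 * a * n) (sym ey) (sym ex) ⟩
  (2 * a) * (n + y) + (2 * a + x) * n + x * y + 8 * a * n
    ≡⟨ solve 4 (λ a n x y → (con 2 :* a) :* (n :+ y) :+ (con 2 :* a :+ x) :* n :+ x :* y :+ con 8 :* a :* n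
         := (con 2 :* a :+ x) :* (n :+ y) :+ con 10 :* a :* n) refl a n x y ⟩
  (2 * a + x) * (n + y) + 10 * a * n
    ≡⟨ cong₂ (λ u v → u * v + 10 * a * n) ex ey ⟩
  (5 * n) * (2 * a) + 10 * a * n
    ≡⟨ solve 2 (λ a n → (con 5 :* n) :* (con 2 :* a) :+ con 10 :* a :* n
         := con 4 :* (con 5 :* (a :* n))) refl a n ⟩
  4 * (5 * (a * n)) ∎)
  where
  open ≤-Reasoning
  open +-*-Solver
  x = 5 * n ∸ 2 * a
  y = 2 * a ∸ n
  ex : 2 * a + x ≡ 5 * n
  ex = m+[n∸m]≡n 2a≤5n
  ey : n + y ≡ 2 * a
  ey = m+[n∸m]≡n n≤2a

-- Tiles of side s / f; the optimal f is about √(n / suc m), and rounding it so that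
-- 2 f² (suc m) ≤ 5 n < 2 (f + 1)² (suc m) keeps the constant below 5.
tiling-arithmetic : ∀ n m s → 1 ≤ n → s ≤ n →
  (∀ f q → f * q ≤ s → f * (f * q) ≤ f * (f * m) + n) → suc s * suc s ≤ 5 * (n * suc m)
tiling-arithmetic n m s 1≤n s≤n tiles with suc m ≤? n
-- Here `n ≤ m`, and `s ≤ n` alone gives `(s + 1)² ≤ (n + 1)(m + 1)`.
... | no m≮n = begin
  suc s * suc s ≤⟨ *-mono-≤ (s≤s s≤n) (s≤s (≤-trans s≤n (≤-pred (≰⇒> m≮n)))) ⟩
  (1 + n) * suc m ≤⟨ *-monoˡ-≤ (suc m) (+-mono-≤ 1≤n (m≤m+n n (3 * n))) ⟩
  5 * n * suc m ≡⟨ *-assoc 5 n (suc m) ⟩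
  5 * (n * suc m) ∎
  where open ≤-Reasoning
-- `f = 1` qualifies because `m < n`, and `f = 5 n + 1` does not. The goal is then proved multiplied
-- by `f²`.
... | yes m<n with threshold (λ f → 2 * (f * f * suc m) ≤? 5 * n) 1 (5 * n)
                     (*-mono-≤ {2} {5} (m≤m+n 2 3) (≤-trans (≤-reflexive (+-identityʳ (suc m))) m<n))
                     (<⇒≱ (≤-trans (m≤m*n (suc (5 * n)) (suc (5 * n)))
                       (≤-trans (m≤m*n _ (suc m)) (m≤n*m _ 2))))
... | f@(suc _) , 1≤f , le , ¬le = *-cancelˡ-≤ (f * f) (begin
  f * f * (suc s * suc s) ≡⟨ solve 2 (λ f s → f :* f :* (s :* s) := (f :* s) :* (f :* s)) refl f (suc s) ⟩
  (f * suc s) * (f * suc s) ≤⟨ *-mono-≤ fs≤ fs≤ ⟩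
  (a + n) * (a + n) ≤⟨ square-of-sum a n le n≤2a ⟩
  5 * (a * n) ≡⟨ solve 3 (λ f n m → con 5 :* ((f :* f :* m) :* n) := f :* f :* (con 5 :* (n :* m))) refl f n (suc m) ⟩
  f * f * (5 * (n * suc m)) ∎)
  where
  open ≤-Reasoning
  open +-*-Solver
  a = f * f * suc m
  q = s / f
  s<f[q+1] : suc s ≤ f * suc q
  s<f[q+1] = begin
    suc s ≡⟨ cong suc (m≡m%n+[m/n]*n s f) ⟩
    suc (s % f) + q * f ≤⟨ +-monoˡ-≤ (q * f) (m%n<n s f) ⟩
    f + q * f ≡⟨ *-comm (suc q) f ⟩
    f * suc q ∎
  fs≤ : f * suc s ≤ a + n
  fs≤ = begin
    f * suc s ≤⟨ *-monoʳ-≤ f s<f[q+1] ⟩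
    f * (f * suc q) ≡⟨ solve 2 (λ f q → f :* (f :* (con 1 :+ q)) := f :* (f :* q) :+ f :* f) refl f q ⟩
    f * (f * q) + f * f ≤⟨ +-monoˡ-≤ (f * f) (tiles f q (subst (_≤ s) (*-comm q f) (m/n*n≤m s f))) ⟩
    f * (f * m) + n + f * f ≡⟨ solve 3 (λ f m n → f :* (f :* m) :+ n :+ f :* f := f :* f :* (con 1 :+ m) :+ n) refl f m n ⟩
    a + n ∎
  -- Failure at `f + 1`, together with `f + 1 ≤ 2 f`, yields the lower bound on `a` that
  -- `square-of-sum` asks for.
  5n<8a : 5 * n < 4 * (2 * a)
  5n<8a = begin-strict
    5 * n <⟨ ≰⇒> ¬le ⟩
    2 * ((1 + f) * (1 + f) * suc m)
      ≤⟨ *-monoʳ-≤ 2 (*-monoˡ-≤ (suc m) (*-mono-≤ (+-monoˡ-≤ f 1≤f) (+-monoˡ-≤ f 1≤f))) ⟩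
    2 * ((f + f) * (f + f) * suc m)
      ≡⟨ solve 2 (λ f m → con 2 :* ((f :+ f) :* (f :+ f) :* m) := con 4 :* (con 2 :* (f :* f :* m))) refl f (suc m) ⟩
    4 * (2 * a) ∎
  n≤2a : n ≤ 2 * a
  n≤2a = ≮⇒≥ λ 2a<n → <⇒≱ 5n<8a (≤-trans (*-monoʳ-≤ 4 (<⇒≤ 2a<n)) (*-monoˡ-≤ n (m≤n+m 4 1)))

^-distribʳ-* : ∀ k m n → (m * n) ^ k ≡ m ^ k * n ^ k
^-distribʳ-* zero    m n = refl
^-distribʳ-* (suc k) m n = trans (cong (m * n *_) (^-distribʳ-* k m n))
  (*-interchange m n (m ^ k) (n ^ k))
  where open import Algebra.Properties.CommutativeSemigroup *-commutativeSemigroup using (interchange)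

-- Think of `suc e` as `2 ^ j`: then `suc e + suc e` is `2 ^ (j + 1)` and `e + suc e` is one less.
-- The inequality `sq` is raised to the power `suc e` and the previous bound substituted.
power-step : ∀ e n m m' t → suc m' * suc m' ≤ 5 * (n * suc m) →
  suc m ^ suc e ≤ 5 ^ suc e * n ^ e * t →
  suc m' ^ (suc e + suc e) ≤ 5 ^ (suc e + suc e) * n ^ (e + suc e) * t
power-step e n m m' t sq ih = begin
  suc m' ^ (suc e + suc e) ≡⟨ ^-distribˡ-+-* (suc m') (suc e) (suc e) ⟩
  suc m' ^ suc e * suc m' ^ suc e ≡⟨ ^-distribʳ-* (suc e) (suc m') (suc m') ⟨
  (suc m' * suc m') ^ suc e ≤⟨ ^-monoˡ-≤ (suc e) sq ⟩
  (5 * (n * suc m)) ^ suc e ≡⟨ ^-distribʳ-* (suc e) 5 (n * suc m) ⟩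
  5 ^ suc e * (n * suc m) ^ suc e ≡⟨ cong (5 ^ suc e *_) (^-distribʳ-* (suc e) n (suc m)) ⟩
  5 ^ suc e * (n ^ suc e * suc m ^ suc e) ≤⟨ *-monoʳ-≤ (5 ^ suc e) (*-monoʳ-≤ (n ^ suc e) ih) ⟩
  5 ^ suc e * (n ^ suc e * (5 ^ suc e * n ^ e * t))
    ≡⟨ solve 4 (λ p u v t → p :* (u :* (p :* v :* t)) := p :* p :* (v :* u) :* t) refl
         (5 ^ suc e) (n ^ suc e) (n ^ e) t ⟩
  5 ^ suc e * 5 ^ suc e * (n ^ e * n ^ suc e) * t
    ≡⟨ cong₂ (λ u v → u * v * t) (^-distribˡ-+-* 5 (suc e) (suc e)) (^-distribˡ-+-* n e (suc e)) ⟨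
  5 ^ (suc e + suc e) * n ^ (e + suc e) * t ∎
  where
  open ≤-Reasoning
  open +-*-Solver

-- Rooted trees

-- The field `edge` carries the tree structure: every edge joins a vertex to its parent. The parent
-- of the root is an arbitrary value.
record Rooted (T : Graph) (R : ℕ) : Set where
  field
    root   : Fin (n T)
    depth  : Fin (n T) → ℕ
    parent : Fin (n T) → Fin (n T)
    depth≤       : ∀ u → depth u ≤ R
    depth-root   : depth root ≡ 0
    depth-zero   : ∀ u → depth u ≡ 0 → u ≡ root
    depth-parent : ∀ u {d} → depth u ≡ suc d → depth (parent u) ≡ d

  ChildOf : Fin (n T) → Fin (n T) → Set
  ChildOf v u = parent u ≡ v × depth u ≡ suc (depth v)

  field
    edge : ∀ u v → adj T u v ≡ true → ChildOf v u ⊎ ChildOf u v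

  up : ℕ → Fin (n T) → Fin (n T)
  up zero    u = u
  up (suc k) u = up k (parent u)

  depth-up : ∀ k {e} u → depth u ≡ k + e → depth (up k u) ≡ e
  depth-up zero    u eq = eq
  depth-up (suc k) u eq = depth-up k (parent u) (depth-parent u eq)

  -- The ancestor of u at depth d, or u itself when it is not that deep.
  anc : ℕ → Fin (n T) → Fin (n T)
  anc d u = up (depth u ∸ d) u

  anc-self : ∀ {d u} → depth u ≤ d → anc d u ≡ u
  anc-self {d} {u} le = cong (λ k → up k u) (m≤n⇒m∸n≡0 le)

  depth-anc : ∀ {d u} → d ≤ depth u → depth (anc d u) ≡ d
  depth-anc {d} {u} le = depth-up (depth u ∸ d) u (sym (m∸n+n≡m le))

  anc-child : ∀ {d u v} → ChildOf v u → d ≤ depth v → anc d u ≡ anc d v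
  anc-child {d} {u} {v} (refl , eq) le =
    cong (λ k → up k u) (trans (cong (_∸ d) eq) (+-∸-assoc 1 le))

  -- Consequently a connected set of vertices of depth at least `d` has a single ancestor at depth
  -- `d`.
  anc-edge : ∀ {d u v} → adj T u v ≡ true → d ≤ depth u → d ≤ depth v → anc d u ≡ anc d v
  anc-edge {d} {u} {v} uv du dv with edge u v uv
  ... | inj₁ v→u = anc-child v→u dv
  ... | inj₂ u→v = sym (anc-child u→v du)

  -- The component of T - w containing s ≠ w, named by its child of w, or by w itself when it lies above w.
  comp : Fin (n T) → Fin (n T) → Fin (n T)
  comp w s with anc (depth w) s ≟F w
  ... | yes _ = anc (suc (depth w)) s
  ... | no  _ = w

  comp-below : ∀ {w s} → anc (depth w) s ≡ w → comp w s ≡ anc (suc (depth w)) s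
  comp-below {w} {s} eq with anc (depth w) s ≟F w
  ... | yes _ = refl
  ... | no ≢w = contradiction eq ≢w

  comp-above : ∀ {w s} → anc (depth w) s ≢ w → comp w s ≡ w
  comp-above {w} {s} ≢w with anc (depth w) s ≟F w
  ... | yes eq = contradiction eq ≢w
  ... | no _ = refl

  comp-child : ∀ {w s c} → comp w s ≡ c → c ≢ w → anc (suc (depth w)) s ≡ c
  comp-child {w} {s} eq c≢w with anc (depth w) s ≟F w
  ... | yes _ = eq
  ... | no _ = contradiction (sym eq) c≢w

  below-depth : ∀ {w s} → anc (depth w) s ≡ w → s ≢ w → depth w < depth s
  below-depth {w} {s} eq s≢w = ≰⇒> λ le → s≢w (trans (sym (anc-self le)) eq)

  -- If `s'` is at least as deep as `w`, both vertices have the same ancestor at the depth of `w`;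
  -- when that is `w`, they lie below the same child, since `s' ≢ w`. Otherwise neither vertex is
  -- deeper than `w`, and being different from `w` they are not below it.
  comp-childOf : ∀ {w s s'} → ChildOf s' s → s ≢ w → s' ≢ w → comp w s ≡ comp w s'
  comp-childOf {w} {s} {s'} ch s≢w s'≢w with depth w ≤? depth s' | anc (depth w) s' ≟F w
  ... | yes le | yes eq = trans (comp-below (trans (anc-child ch le) eq))
                            (anc-child ch (below-depth eq s'≢w))
  ... | yes le | no ≢w = comp-above λ eq → ≢w (trans (sym (anc-child ch le)) eq)
  ... | no ≰ | yes eq = contradiction (trans (sym (anc-self (≰⇒≥ ≰))) eq) s'≢w
  ... | no ≰ | no ≢w = comp-above λ eq → s≢w
    (trans (sym (anc-self (subst (_≤ depth w) (sym (proj₂ ch)) (≰⇒> ≰)))) eq)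

  comp-edge : ∀ {w s s'} → adj T s s' ≡ true → s ≢ w → s' ≢ w → comp w s ≡ comp w s'
  comp-edge {w} {s} {s'} ss' s≢w s'≢w with edge s s' ss'
  ... | inj₁ ch = comp-childOf ch s≢w s'≢w
  ... | inj₂ ch = sym (comp-childOf ch s'≢w s≢w)

  -- If every X w avoids w then X w points into one component of T - w; following these
  -- components downwards from the root never ends, because X w meets X c.
  no-evasion : {V : Set} (rep : V → Fin (n T)) (X : Fin (n T) → V → Set) →
    (∀ w w' → ∃ λ z → X w z × X w' z) →
    (∀ w z → X w z → rep z ≢ w) →
    (∀ w u v → X w u → X w v → comp w (rep u) ≡ comp w (rep v)) → ⊥
  no-evasion {V} rep X meet avoid const =
    let w , eq , _ = down (suc R) in <⇒≱ (≤-reflexive (sym eq)) (depth≤ w)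
    where
    Down : Fin (n T) → Set
    Down w = ∃ λ z → X w z × anc (depth w) (rep z) ≡ w
    down : ∀ d → ∃ λ w → depth w ≡ d × Down w
    down zero = let z , Xz , _ = meet root root in
      root , depth-root , z , Xz ,
      depth-zero _ (trans (cong (λ d → depth (anc d (rep z))) depth-root) (depth-anc z≤n))
    down (suc d) with w , refl , z , Xz , below ← down d =
      c , depth-c , z' , Xcz' , subst (λ d → anc d (rep z') ≡ c) (sym depth-c)
        (comp-child (trans (const w z' z Xwz' Xz) (comp-below below)) c≢w)
      where
      c : Fin (n T)
      c = anc (suc (depth w)) (rep z)
      depth-c : depth c ≡ suc (depth w)
      depth-c = depth-anc (below-depth below (avoid w z Xz))
      c≢w : c ≢ w
      c≢w eq = 1+n≢n (trans (sym depth-c) (cong depth eq))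
      z' = proj₁ (meet w c)
      Xwz' = proj₁ (proj₂ (meet w c))
      Xcz' = proj₂ (proj₂ (meet w c))

-- Paths, cycles and breadth-first search

data Path (G : Graph) : Fin (n G) → List (Fin (n G)) → Fin (n G) → Set where
  []  : ∀ {x} → Path G x [] x
  _∷_ : ∀ {x w y ws} → adj G x w ≡ true → Path G w ws y → Path G x (w ∷ ws) y

lookup-injective : ∀ {A : Set} {xs : List A} → Unique xs → ∀ {i j} → lookup xs i ≡ lookup xs j → i ≡ j
lookup-injective (_ ∷ _)      {zero}  {zero}  eq = refl
lookup-injective (x∉ ∷ _)     {zero}  {suc j} eq = contradiction eq (All.lookup x∉ (∈-lookup j))
lookup-injective (x∉ ∷ _)     {suc i} {zero}  eq = contradiction (sym eq) (All.lookup x∉ (∈-lookup i))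
lookup-injective (_ ∷ uniq)   {suc i} {suc j} eq = cong suc (lookup-injective uniq eq)

module _ {G : Graph} where

  path-snoc : ∀ {x xs y z} → Path G x xs y → adj G y z ≡ true → Path G x (xs ++ z ∷ []) z
  path-snoc []       yz = yz ∷ []
  path-snoc (e ∷ p)  yz = e ∷ path-snoc p yz

  path-end : ∀ {x xs y} → Path G x xs y → lookup (x ∷ xs) (fromℕ (length xs)) ≡ y
  path-end []      = refl
  path-end (e ∷ p) = path-end p

  path-end-∈ : ∀ {x w ws y} → Path G x (w ∷ ws) y → y ∈ w ∷ ws
  path-end-∈ (e ∷ [])       = here refl
  path-end-∈ (e ∷ (e' ∷ p)) = there (path-end-∈ (e' ∷ p))

  path-edges : ∀ {x xs y} → Path G x xs y → ∀ (i : Fin (length xs)) →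
    adj G (lookup (x ∷ xs) (inject₁ i)) (lookup (x ∷ xs) (suc i)) ≡ true
  path-edges (e ∷ p) zero    = e
  path-edges (e ∷ p) (suc i) = path-edges p i

  -- The list of a path omits its first vertex, so the shape `a ∷ b ∷ ws` supplies the three
  -- vertices that a cycle must have.
  path-cycle : ∀ {x a b ws y} → Path G x (a ∷ b ∷ ws) y → Unique (x ∷ a ∷ b ∷ ws) →
    adj G y x ≡ true → HasCycle G
  path-cycle {x} {a} {b} {ws} p uniq yx = length ws , lookup (x ∷ a ∷ b ∷ ws) ,
    lookup-injective uniq , path-edges p ,
    subst (λ y → adj G y x ≡ true) (sym (path-end p)) yx

unique-snoc : ∀ {A : Set} {xs : List A} {z} → Unique xs → All (_≢ z) xs → Unique (xs ++ z ∷ [])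
unique-snoc uniq ≢z = unique-++⁺ uniq ([] ∷ []) λ { (z∈ , here refl) → All.lookup ≢z z∈ refl }

module BreadthFirst {T : Graph} (tree : IsTree T) (root : Fin (n T)) {R : ℕ}
  (near : ∀ u → DistLe T root u R) where

  open IsTree tree
  open IsSimple simple

  -- Walks to the root of exact length, by recursion on the length: this makes existence decidable,
  -- so that a shortest length can be searched for.
  Reach : ℕ → Fin (n T) → Set
  Reach zero    u = u ≡ root
  Reach (suc l) u = ∃ λ w → adj T u w ≡ true × Reach l w

  reach? : ∀ l u → Dec (Reach l u)
  reach? zero    u = u ≟F root
  reach? (suc l) u = any? λ w → (adj T u w ≟B true) ×-dec reach? l w

  adj-sym : ∀ {u v} → adj T u v ≡ true → adj T v u ≡ true
  adj-sym {u} {v} uv = trans (symm v u) uv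

  walk-reach : ∀ {u v l k} → Walk T u v l → Reach k u → Reach (l + k) v
  walk-reach (here _) r = r
  walk-reach {v = v} {l = suc l} {k = k} (step _ uw p) r =
    subst (λ j → Reach j v) (+-suc l k) (walk-reach p (_ , adj-sym uw , r))

  Nearest : Fin (n T) → ℕ → Set
  Nearest u d = Reach d u × (∀ l → Reach l u → d ≤ l)

  least : ∀ u l → Reach l u → ∃ (Nearest u)
  least u l r = search l 0 (λ _ _ → z≤n) (subst (λ j → Reach j u) (sym (+-identityʳ l)) r)
    where
    search : ∀ k d → (∀ j → Reach j u → d ≤ j) → Reach (k + d) u → ∃ (Nearest u)
    search k d min r with reach? d u
    ... | yes r' = d , r' , min
    search zero d min r | no ¬r = contradiction r ¬r
    search (suc k) d min r | no ¬r = search k (suc d)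
      (λ j rj → ≤∧≢⇒< (min j rj) λ { refl → ¬r rj })
      (subst (λ j → Reach j u) (sym (+-suc k d)) r)

  nearest : ∀ u → ∃ (Nearest u)
  nearest u = let l , _ , p = near u in
    least u l (subst (λ j → Reach j u) (+-identityʳ l) (walk-reach p refl))

  depth : Fin (n T) → ℕ
  depth u = proj₁ (nearest u)

  reach-depth : ∀ u → Reach (depth u) u
  reach-depth u = proj₁ (proj₂ (nearest u))

  depth-min : ∀ {u l} → Reach l u → depth u ≤ l
  depth-min {u} {l} r = proj₂ (proj₂ (nearest u)) l r

  -- The first step of a shortest walk to the root; were `w` any nearer, so would `u` be.
  closer : ∀ {d} u → depth u ≡ suc d → ∃ λ w → adj T u w ≡ true × depth w ≡ d
  closer u eq with w , uw , r ← subst (λ d → Reach d u) eq (reach-depth u) =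
    w , uw , ≤-antisym (depth-min r)
      (≤-pred (subst (_≤ suc (depth w)) eq (depth-min (w , uw , reach-depth w))))

  depth-zero : ∀ u → depth u ≡ 0 → u ≡ root
  depth-zero u eq = subst (λ d → Reach d u) eq (reach-depth u)

  higher : ∀ {d a v} → depth a ≡ d → suc d ≤ depth v → a ≢ v
  higher refl le refl = 1+n≰n le

  -- Extending a path at both ends towards the root produces a cycle as soon as the two ends agree.
  no-level-path : ∀ d {x w ws y} → depth x ≡ d → depth y ≡ d → Path T x (w ∷ ws) y →
    Unique (x ∷ w ∷ ws) → All (λ v → d ≤ depth v) (x ∷ w ∷ ws) → ⊥
  no-level-path zero dx dy p (x∉ ∷ _) _ =
    All.lookup x∉ (path-end-∈ p) (trans (depth-zero _ dx) (sym (depth-zero _ dy)))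
  no-level-path (suc d) {x} {w} {ws} {y} dx dy p uniq deep
    with a , xa , da ← closer x dx | b , yb , db ← closer y dy
    with a ≟F b
  ... | yes refl = acyclic (path-cycle (adj-sym xa ∷ p) (All.map (higher da) deep ∷ uniq) yb)
  -- Both new ends lie strictly above the old path, so the extended path is again simple.
  ... | no a≢b = no-level-path d da db (adj-sym xa ∷ path-snoc p yb)
    (++⁺ (All.map (higher da) deep) (a≢b ∷ []) ∷
     unique-snoc uniq (All.map (λ le eq → higher db le (sym eq)) deep))
    (≤-reflexive (sym da) ∷ ++⁺ (All.map <⇒≤ deep) (≤-reflexive (sym db) ∷ []))

  adj-≢ : ∀ {u v} → adj T u v ≡ true → u ≢ v
  adj-≢ {u} uv refl = contradiction (trans (sym uv) (irrefl u)) λ ()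

  depth-step : ∀ {u v} → adj T u v ≡ true → depth u ≤ suc (depth v)
  depth-step {v = v} uv = depth-min (v , uv , reach-depth v)

  no-level-edge : ∀ {u v} → adj T u v ≡ true → depth u ≢ depth v
  no-level-edge {u} {v} uv eq = no-level-path (depth v) eq refl (uv ∷ [])
    ((adj-≢ uv ∷ []) ∷ [] ∷ []) (≤-reflexive (sym eq) ∷ ≤-refl ∷ [])

  -- Two different parents would be the ends of the path `a`, `u`, `b`, which `no-level-path`
  -- excludes.
  closer-unique : ∀ {u a b} → adj T u a ≡ true → adj T u b ≡ true →
    suc (depth a) ≡ depth u → suc (depth b) ≡ depth u → a ≡ b
  closer-unique {u} {a} {b} ua ub da db with a ≟F b
  ... | yes eq = eq
  ... | no a≢b = ⊥-elim (no-level-path (depth a) refl b=a (adj-sym ua ∷ ub ∷ [])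
    ((adj-≢ (adj-sym ua) ∷ a≢b ∷ []) ∷ (adj-≢ ub ∷ []) ∷ [] ∷ [])
    (≤-refl ∷ ≤-trans (n≤1+n _) (≤-reflexive da) ∷ ≤-reflexive (sym b=a) ∷ []))
    where
    b=a : depth b ≡ depth a
    b=a = suc-injective (trans db (sym da))

  -- The depth is a separate argument so that it can be matched on; the root is its own parent by
  -- default.
  parentOf : ∀ u d → depth u ≡ d → Fin (n T)
  parentOf u zero    eq = u
  parentOf u (suc d) eq = proj₁ (closer u eq)

  parentOf-suc : ∀ u d eq {e} → d ≡ suc e →
    adj T u (parentOf u d eq) ≡ true × depth (parentOf u d eq) ≡ e
  parentOf-suc u (suc d) eq refl = proj₂ (closer u eq)

  parent : Fin (n T) → Fin (n T)
  parent u = parentOf u (depth u) refl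

  parent-suc : ∀ u {d} → depth u ≡ suc d → adj T u (parent u) ≡ true × depth (parent u) ≡ d
  parent-suc u = parentOf-suc u (depth u) refl

  childOf : ∀ {u v} → adj T u v ≡ true → depth v < depth u → parent u ≡ v × depth u ≡ suc (depth v)
  childOf {u} {v} uv lt = closer-unique (proj₁ (parent-suc u du)) uv
      (trans (cong suc (proj₂ (parent-suc u du))) (sym du)) (sym du) , du
    where
    du : depth u ≡ suc (depth v)
    du = ≤-antisym (depth-step uv) lt

  rooted : Rooted T R
  rooted = record
    { root = root
    ; depth = depth
    ; parent = parent
    ; depth≤ = λ u → let l , l≤R , p = near u in
        ≤-trans (depth-min (subst (λ j → Reach j u) (+-identityʳ l) (walk-reach p refl))) l≤R
    ; depth-root = n≤0⇒n≡0 (depth-min {root} {0} refl)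
    ; depth-zero = depth-zero
    ; depth-parent = λ u eq → proj₂ (parent-suc u eq)
    ; edge = oriented
    }
    where
    oriented : ∀ u v → adj T u v ≡ true →
      (parent u ≡ v × depth u ≡ suc (depth v)) ⊎ (parent v ≡ u × depth v ≡ suc (depth u))
    oriented u v uv with depth v <? depth u
    ... | yes lt = inj₁ (childOf uv lt)
    ... | no ≮ = inj₂ (childOf (adj-sym uv) (≤∧≢⇒< (≮⇒≥ ≮) (no-level-edge uv)))

fin-max : ∀ {m} (f : Fin m → ℕ) → ∃ λ R → ∀ i → f i ≤ R
fin-max {zero} f = 0 , λ ()
fin-max {suc m} f with R , le ← fin-max (λ i → f (suc i)) = f zero + R ,
  λ { zero → m≤m+n _ R ; (suc i) → ≤-trans (le i) (m≤n+m R _) }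

-- Serves the tree of a decomposition, where any root and any bound on the depths will do.
tree-rooted : ∀ {T} → IsTree T → ∃ (Rooted T)
tree-rooted {mkGraph (suc _) _} tree =
  let R , le = fin-max (λ u → proj₁ (IsTree.connected tree zero u))
  in R , BreadthFirst.rooted tree zero (λ u → let l , p = IsTree.connected tree zero u in l , le u , p)
tree-rooted {mkGraph zero _} tree = contradiction (IsTree.nonempty tree) λ ()

open Rooted

-- Crosses, minors and lexicographic products

-- The bag at `w` consists of the `e w h` with `S w h` true. This covers both bramble arguments: `D`
-- is `T` with its fibres as bags, or the tree of a decomposition of `H`.
module Crosses {V : Set} {Adj : V → V → Set} {K R N : ℕ} {D : Graph} (M : GridModel Adj K)
  (rt : Rooted D R) (rep : V → Fin (n D)) (e : Fin (n D) → Fin N → V) (S : Fin (n D) → Fin N → Bool)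
  where

  InBag : Fin (n D) → V → Set
  InBag w z = ∃ λ h → S w h ≡ true × e w h ≡ z

  -- If `B < s`, every bag misses some selected row and some selected column. Their cross is
  -- connected, so `same` keeps it in one component of `D` minus `w`, and `own` keeps its
  -- representatives off `w`. Any two crosses meet, which contradicts `no-evasion`.
  cross-bound : ∀ {B a k c l P Q s} → (∀ w → card (S w) ≤ B) → a + k ≤ K → c + l ≤ K →
    (∀ {z} → Region M a k c l (True P) (True Q) z → InBag (rep z) z) →
    (∀ {w u v} → Region M a k c l (True P) (True Q) u → Region M a k c l (True P) (True Q) v →
      Adj u v → ¬ InBag w u → ¬ InBag w v → comp rt w (rep u) ≡ comp rt w (rep v)) →
    s ≤ count P a k → s ≤ count Q c l → s ≤ B
  cross-bound {B} {a} {k} {c} {l} {P} {Q} {s} S≤ a≤ c≤ own same s≤P s≤Q =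
    ≮⇒≥ λ B<s → no-evasion rt rep (Cross B<s) (meet B<s) (avoid B<s)
      λ w u v → region-connected M (comp rt w ∘ rep) (_≡ x B<s w) (_≡ y B<s w) a≤ c≤
        (x B<s w , proj₁ (proj₂ (free-row B<s w)) , refl)
        (y B<s w , proj₁ (proj₂ (free-col B<s w)) , refl)
        (λ Xu Xv uv → same (inside B<s w Xu) (inside B<s w Xv) uv (outside B<s w Xu) (outside B<s w Xv))
    where
    open Damage
    leftover : ∀ {p u h} → s ≤ p → p ≤ u + h → h ≤ B → B < s → 1 ≤ u
    leftover {p} {zero} s≤p p≤ h≤B B<s = contradiction (≤-trans s≤p (≤-trans p≤ h≤B)) (<⇒≱ B<s)
    leftover {p} {suc u} _ _ _ _ = s≤s z≤n
    module _ (B<s : B < s) (w : Fin (n D)) where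
      U U' : ℕ → Bool
      U = undamaged (e w) (S w) M c l P
      U' = undamaged (e w) (S w) (transpose M) a k Q
      free-row : ∃ λ x → In a k x × U x ≡ true
      free-row = count-witness U a k (leftover s≤P (undamaged-count (e w) (S w) M a k c l P)
        (≤-trans (hits≤card (e w) (S w) M a k c l) (S≤ w)) B<s)
      free-col : ∃ λ y → In c l y × U' y ≡ true
      free-col = count-witness U' c l (leftover s≤Q (undamaged-count (e w) (S w) (transpose M) c l a k Q)
        (≤-trans (hits≤card (e w) (S w) (transpose M) c l a k) (S≤ w)) B<s)
      x y : ℕ
      x = proj₁ free-row
      y = proj₁ free-col
      Px = undamaged-elim (e w) (S w) M c l P x (proj₂ (proj₂ free-row))
      Qy = undamaged-elim (e w) (S w) (transpose M) a k Q y (proj₂ (proj₂ free-col))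
      Cross : V → Set
      Cross = Region M a k c l (_≡ x) (_≡ y)
      inside : ∀ {z} → Cross z → Region M a k c l (True P) (True Q) z
      inside (i , inj₁ r) = i , inj₁ (subst (True P) (sym r) (proj₁ Px))
      inside (i , inj₂ r) = i , inj₂ (subst (True Q) (sym r) (proj₁ Qy))
      outside : ∀ {z} → Cross z → ¬ InBag w z
      outside ((_ , j) , inj₁ r) (h , Sh , refl) = proj₂ Px h (Sh , r , j)
      outside ((i , _) , inj₂ r) (h , Sh , refl) = proj₂ Qy h (Sh , r , i)
    avoid : ∀ B<s w z → Cross B<s w z → rep z ≢ w
    avoid B<s w z Xz refl = outside B<s w Xz (own (inside B<s w Xz))
    meet : ∀ B<s w w' → ∃ λ z → Cross B<s w z × Cross B<s w' z
    meet B<s w w' =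
      let _ , i , _ = free-row B<s w
          _ , j , _ = free-col B<s w'
          z , r , c' = cell-nonempty M (in-bounded i a≤) (in-bounded j c≤)
          win = subst (In a k) (sym r) i , subst (In c l) (sym c') j
      in z , (win , inj₁ r) , (win , inj₂ c')

-- From grid minors to grid models

walk-head : ∀ {G S u v l} → WalkIn G S u v l → S u ≡ true
walk-head (here Su)     = Su
walk-head (step Su _ _) = Su

walk-invariant : ∀ {G S} {A : Set} (φ : Fin (n G) → A) →
  (∀ {u v} → S u ≡ true → S v ≡ true → adj G u v ≡ true → φ u ≡ φ v) →
  ∀ {u v l} → WalkIn G S u v l → φ u ≡ φ v
walk-invariant φ inv (here _)       = refl
walk-invariant φ inv (step Su uw p) = trans (inv Su (walk-head p) uw) (walk-invariant φ inv p)

-- Vertices outside all branch sets are placed at (k , k), which is out of range.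
minor-model : ∀ {G k} → Minor (Grid k) G → GridModel (λ u v → adj G u v ≡ true) k
minor-model {G} {k} μ = record
  { row = proj₁ ∘ position
  ; col = proj₂ ∘ position
  ; cell-nonempty = λ x< y< → let z , bz = nonempty (cell x< y<) in z , placed x< y< bz
  ; cell-connected = λ φ x< y< inv cu cv →
      let _ , p = connected (cell x< y<) _ _ (located x< y< cu) (located x< y< cv)
      in walk-invariant φ (λ bu bv → inv (placed x< y< bu) (placed x< y< bv)) p
  ; row-step = λ x< y< →
      let u , v , bu , bv , uv = edges _ _ (row-edge (fromℕ< x<) (fromℕ< (<⇒≤ y<)) (fromℕ< y<)
            (trans (toℕ-fromℕ< y<) (cong suc (sym (toℕ-fromℕ< (<⇒≤ y<))))))
      in u , v , placed x< (<⇒≤ y<) bu , placed x< y< bv , uv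
  ; col-step = λ x< y< →
      let u , v , bu , bv , uv = edges _ _ (col-edge (fromℕ< (<⇒≤ x<)) (fromℕ< x<) (fromℕ< y<)
            (trans (toℕ-fromℕ< x<) (cong suc (sym (toℕ-fromℕ< (<⇒≤ x<))))))
      in u , v , placed (<⇒≤ x<) y< bu , placed x< y< bv , uv
  }
  where
  open Minor μ
  position : Fin (n G) → ℕ × ℕ
  position z with any? (λ a → branch a z ≟B true)
  ... | yes (a , _) = let i , j = remQuot {k} k a in toℕ i , toℕ j
  ... | no _ = k , k
  cell : ∀ {x y} → x < k → y < k → Fin (k * k)
  cell x< y< = combine (fromℕ< x<) (fromℕ< y<)
  placed : ∀ {x y z} (x< : x < k) (y< : y < k) → branch (cell x< y<) z ≡ true →
    proj₁ (position z) ≡ x × proj₂ (position z) ≡ y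
  placed {x} {y} {z} x< y< bz with any? (λ a → branch a z ≟B true)
  ... | no none = contradiction (_ , bz) none
  ... | yes (a , ba) with refl ← disjoint a (cell x< y<) z ba bz =
    trans (cong (toℕ ∘ proj₁) (remQuot-combine {k} {k} _ _)) (toℕ-fromℕ< x<) ,
    trans (cong (toℕ ∘ proj₂) (remQuot-combine {k} {k} _ _)) (toℕ-fromℕ< y<)
  located : ∀ {x y z} (x< : x < k) (y< : y < k) →
    proj₁ (position z) ≡ x × proj₂ (position z) ≡ y → branch (cell x< y<) z ≡ true
  located {x} {y} {z} x< y< (rx , cy) with any? (λ a → branch a z ≟B true)
  ... | no _ = contradiction rx λ { refl → <-irrefl refl x< }
  ... | yes (a , ba) = subst (λ a → branch a z ≡ true)
    (trans (sym (combine-remQuot {k} k a))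
      (cong₂ combine (toℕ-injective (trans rx (sym (toℕ-fromℕ< x<))))
                     (toℕ-injective (trans cy (sym (toℕ-fromℕ< y<))))))
    ba
  consecutive : ∀ {x y} → y ≡ suc x → ∣ x - y ∣ ≡ 1
  consecutive {x} refl = trans (m≤n⇒∣m-n∣≡n∸m (n≤1+n x)) (m+n∸n≡m 1 x)
  row-edge : ∀ i j j' → toℕ j' ≡ suc (toℕ j) → adj (Grid k) (combine i j) (combine i j') ≡ true
  row-edge i j j' eq
    rewrite cong proj₁ (remQuot-combine {k} {k} i j) | cong proj₂ (remQuot-combine {k} {k} i j)
          | cong proj₁ (remQuot-combine {k} {k} i j') | cong proj₂ (remQuot-combine {k} {k} i j')
          | isYes≗does (i ≟F i) | dec-true (i ≟F i) refl
          | isYes≗does (∣ toℕ j - toℕ j' ∣ ≟ 1) | dec-true (∣ toℕ j - toℕ j' ∣ ≟ 1) (consecutive eq) = refl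
  col-edge : ∀ i i' j → toℕ i' ≡ suc (toℕ i) → adj (Grid k) (combine i j) (combine i' j) ≡ true
  col-edge i i' j eq
    rewrite cong proj₁ (remQuot-combine {k} {k} i j) | cong proj₂ (remQuot-combine {k} {k} i j)
          | cong proj₁ (remQuot-combine {k} {k} i' j) | cong proj₂ (remQuot-combine {k} {k} i' j)
          | isYes≗does (j ≟F j) | dec-true (j ≟F j) refl
          | isYes≗does (∣ toℕ i - toℕ i' ∣ ≟ 1) | dec-true (∣ toℕ i - toℕ i' ∣ ≟ 1) (consecutive eq) = ∨-zeroʳ _

width-positive : ∀ {H t} → IsSimple H → (∃ λ u → ∃ λ v → adj H u v ≡ true) → TreeDecomp H t → 1 ≤ t
width-positive {H} simple (u , v , uv) δ =
  let x , bu , bv = TreeDecomp.coverE δ u v uv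
  in ≤-pred (≤-trans (card-two u v u≢v bu bv) (TreeDecomp.width δ x))
  where
  u≢v : u ≢ v
  u≢v refl = contradiction (trans (sym uv) (IsSimple.irrefl simple u)) λ ()

-- Grids in the lexicographic product

module Product (T H : Graph) (simpleT : IsSimple T) {r g t : ℕ} (rt : Rooted T r)
  (M : GridModel (λ u v → adj (Lex T H) u v ≡ true) g) (δ : TreeDecomp H t) (1≤n : 1 ≤ n H) where

  V : Set
  V = Fin (n T * n H)

  τ : V → Fin (n T)
  τ z = proj₁ (remQuot {n T} (n H) z)

  η : V → Fin (n H)
  η z = proj₂ (remQuot {n T} (n H) z)

  combine-τη : ∀ z {w} → τ z ≡ w → combine w (η z) ≡ z
  combine-τη z refl = combine-remQuot {n T} (n H) z

  lex-adj : ∀ {u v} → adj (Lex T H) u v ≡ true →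
    adj T (τ u) (τ v) ≡ true ⊎ (τ u ≡ τ v × adj H (η u) (η v) ≡ true)
  lex-adj {u} {v} uv with adj T (τ u) (τ v) | τ u ≟F τ v
  ... | true  | _      = inj₁ refl
  ... | false | yes eq = inj₂ (eq , uv)

  τ-edge : ∀ {A : Set} (φ : Fin (n T) → A) {u v} → adj (Lex T H) u v ≡ true →
    (adj T (τ u) (τ v) ≡ true → φ (τ u) ≡ φ (τ v)) → φ (τ u) ≡ φ (τ v)
  τ-edge φ {u} {v} uv inv with lex-adj {u} {v} uv
  ... | inj₁ e = inv e
  ... | inj₂ (eq , _) = cong φ eq

  -- The bags are the fibres over the vertices of `T`, of `n H` vertices each, and the window is the
  -- whole grid.
  g≤n : g ≤ n H
  g≤n = Crosses.cross-bound M rt τ combine (λ _ _ → true) {a = 0} {g} {0} {g} {λ _ → true} {λ _ → true}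
    (λ _ → card≤ _) ≤-refl ≤-refl
    (λ {z} _ → η z , refl , combine-τη z refl)
    (λ {w} {u} {v} _ _ uv u∉ v∉ → τ-edge (comp rt w) uv λ e → comp-edge rt e
      (λ eq → u∉ (η u , refl , combine-τη u eq)) (λ eq → v∉ (η v , refl , combine-τη v eq)))
    (count-true (λ _ → true) 0 g (λ _ → refl)) (count-true (λ _ → true) 0 g (λ _ → refl))

  Deep : ℕ → V → Set
  Deep i z = i ≤ depth rt (τ z)

  -- The region is connected and stays at depth at least `i`, so `anc-edge` applies along it;
  -- `suc s` makes sure that some row and some column are selected.
  common-ancestor : ∀ {i a k c l P Q s} → a + k ≤ g → c + l ≤ g →
    (∀ {z} → Region M a k c l (True P) (True Q) z → Deep i z) →
    suc s ≤ count P a k → suc s ≤ count Q c l →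
    ∃ λ v → ∀ {z} → Region M a k c l (True P) (True Q) z → anc rt i (τ z) ≡ v
  common-ancestor {i} {a} {k} {c} {l} {P} {Q} a≤ c≤ deep s≤P s≤Q =
    let x , ix , Px = count-witness P a k (≤-trans (s≤s z≤n) s≤P)
        y , iy , Qy = count-witness Q c l (≤-trans (s≤s z≤n) s≤Q)
        z₀ , rz , cz = cell-nonempty M (in-bounded ix a≤) (in-bounded iy c≤)
    in anc rt i (τ z₀) , λ Rz → region-connected M (anc rt i ∘ τ) (True P) (True Q) a≤ c≤ (x , ix , Px) (y , iy , Qy)
         (λ Ru Rv uv → τ-edge (anc rt i) uv λ e → anc-edge rt e (deep Ru) (deep Rv)) Rz
         ((subst (In a k) (sym rz) ix , subst (In c l) (sym cz) iy) , inj₁ (subst (True P) (sym rz) Px))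

  -- No vertex is deeper than `r`, so the common ancestor is `τ z` itself and the region lies in one
  -- fibre, a copy of `H`. The bags of `δ` there have at most `suc t` vertices.
  leaf-level : Bounded M (Deep r) (suc t)
  leaf-level a k c l P Q a≤ c≤ deep zero s≤P s≤Q = z≤n
  leaf-level a k c l P Q a≤ c≤ deep (suc s) s≤P s≤Q
    with v , all ← common-ancestor a≤ c≤ deep s≤P s≤Q
    with R , rδ ← tree-rooted (TreeDecomp.isTree δ) =
    Crosses.cross-bound M rδ rep (λ _ → combine v) bag width a≤ c≤
      (λ {z} Rz → η z , proj₂ (coverV (η z)) , combine-τη z (over Rz))
      same s≤P s≤Q
    where
    open TreeDecomp δ
    rep : V → Fin (n tree)
    rep z = proj₁ (coverV (η z))
    over : ∀ {z} → Region M a k c l (True P) (True Q) z → τ z ≡ v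
    over {z} Rz = trans (sym (anc-self rt (depth≤ rt (τ z)))) (all Rz)
    -- The nodes whose bags contain `h` are connected in the tree and do not include `w`.
    avoids : ∀ {w h x x'} → bag w h ≢ true → bag x h ≡ true → bag x' h ≡ true →
      comp rδ w x ≡ comp rδ w x'
    avoids {w} {h} {x} {x'} w∌h bx bx' = let _ , p = subtree h x x' bx bx' in
      walk-invariant (comp rδ w)
        (λ bs bs' ss' → comp-edge rδ ss' (λ { refl → w∌h bs }) (λ { refl → w∌h bs' })) p
    same : ∀ {w z z'} → Region M a k c l (True P) (True Q) z → Region M a k c l (True P) (True Q) z' →
      adj (Lex T H) z z' ≡ true →
      ¬ (∃ λ h → bag w h ≡ true × combine v h ≡ z) → ¬ (∃ λ h → bag w h ≡ true × combine v h ≡ z') →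
      comp rδ w (rep z) ≡ comp rδ w (rep z')
    same {w} {z} {z'} Rz Rz' zz' z∉ z'∉ with lex-adj {z} {z'} zz'
    ... | inj₁ e = contradiction
      (trans (sym e) (trans (cong₂ (adj T) (over Rz) (over Rz')) (IsSimple.irrefl simpleT v))) λ ()
    -- The node `x` whose bag holds both ends of the edge links the two representatives.
    ... | inj₂ (_ , e) with x , bx , bx' ← coverE (η z) (η z') e = trans
      (avoids (λ b → z∉ (η z , b , combine-τη z (over Rz))) (proj₂ (coverV (η z))) bx)
      (avoids (λ b → z'∉ (η z' , b , combine-τη z' (over Rz'))) bx' (proj₂ (coverV (η z'))))

  -- `suc m'` is the integer square root of `5 * (n H * suc m)`.
  level-up : ∀ {i m} → Bounded M (Deep (suc i)) m →
    ∃ λ m' → Bounded M (Deep i) m' × suc m' * suc m' ≤ 5 * (n H * suc m)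
  level-up {i} {m} bounded
    with m' , lower , upper ← square-root (5 * (n H * suc m))
           (*-mono-≤ {1} {5} (s≤s z≤n) (*-mono-≤ 1≤n (s≤s (z≤n {m})))) = m' , bounded' , lower
    where
    bounded' : Bounded M (Deep i) m'
    bounded' a k c l P Q a≤ c≤ deep zero s≤P s≤Q = z≤n
    bounded' a k c l P Q a≤ c≤ deep s@(suc _) s≤P s≤Q
      with v , all ← common-ancestor a≤ c≤ deep s≤P s≤Q =
      -- If `s` exceeded `m'`, then `suc s` would be at least `suc (suc m')`, whose square is
      -- already too large.
      ≤-pred (≤-pred (≰⇒> λ ≤s → <⇒≱ upper (≤-trans (*-mono-≤ ≤s ≤s)
        (tiling-arithmetic (n H) m s 1≤n s≤n tiles))))
      where
      s≤n : s ≤ n H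
      s≤n = ≤-trans s≤P (≤-trans (count≤ P a k) (≤-trans (m≤n+m k a) (≤-trans a≤ g≤n)))
      tiles : ∀ f q → f * q ≤ s → f * (f * q) ≤ f * (f * m) + n H
      tiles f q fq≤s = ≤-trans
        (Tiles.tiling M (combine v) (λ _ → true)
          (λ z → Deep i z × anc rt i (τ z) ≡ v) (Deep (suc i))
          -- The whole fibre over `v` is deleted: a vertex of depth exactly `i` is its own ancestor
          -- there, so it lies over `v`.
          (λ { {z} (i≤ , eq) unhit → ≤∧≢⇒< i≤ λ i≡ → unhit (η z) refl
               (combine-τη z (trans (sym (anc-self rt (≤-reflexive (sym i≡)))) eq)) })
          bounded f f a k c l P Q a≤ c≤ (λ Rz → deep Rz , all Rz)
          (≤-trans fq≤s s≤P) (≤-trans fq≤s s≤Q))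
        (+-monoʳ-≤ (f * (f * m)) (card≤ _))

  -- Writing `2 ^ j` as `suc e` keeps truncated subtraction out of the exponent of `n H`.
  levels : 1 ≤ t → ∀ j i → i + j ≡ r → ∃ λ m → Bounded M (Deep i) m ×
    ∃ λ e → 2 ^ j ≡ suc e × suc m ^ suc e ≤ 5 ^ suc e * n H ^ e * t
  levels 1≤t zero i eq = suc t ,
    subst (λ i → Bounded M (Deep i) (suc t)) (trans (sym eq) (+-identityʳ i)) leaf-level ,
    0 , refl , (begin
      suc (suc t) * 1 ≡⟨ *-identityʳ _ ⟩
      -- The constant 5 absorbs the bound `t + 1` and the further successor because `1 ≤ t`.
      2 + t           ≤⟨ +-monoˡ-≤ t (*-mono-≤ (m≤m+n 2 2) 1≤t) ⟩
      4 * t + t       ≡⟨ +-comm (4 * t) t ⟩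
      5 * t           ∎)
    where open ≤-Reasoning
  levels 1≤t (suc j) i eq
    with m , bounded , e , 2^j , ih ← levels 1≤t j (suc i) (trans (sym (+-suc i j)) eq)
    with m' , bounded' , sq ← level-up bounded =
    m' , bounded' , e + suc e ,
    trans (cong (λ p → p + (p + 0)) 2^j) (cong (suc e +_) (+-identityʳ (suc e))) ,
    power-step e (n H) m m' t sq ih

  gm-bound : 1 ≤ t → g ^ (2 ^ r) ≤ 5 ^ (2 ^ r) * n H ^ (2 ^ r ∸ 1) * t
  gm-bound 1≤t with m , bounded , e , 2^r , le ← levels 1≤t r 0 refl rewrite 2^r =
    -- At level 0 every vertex is deep enough, so all `g` rows and columns of the grid may be
    -- selected.
    ≤-trans (^-monoˡ-≤ (suc e) (m≤n⇒m≤1+n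
      (bounded 0 g 0 g (λ _ → true) (λ _ → true) ≤-refl ≤-refl (λ _ → z≤n) g
        (count-true (λ _ → true) 0 g (λ _ → refl)) (count-true (λ _ → true) 0 g (λ _ → refl))))) le

theorem13 : (T H : Graph) (r g t : ℕ) →
    IsTree T → IsRadius T r →
    IsSimple H → (∃ λ u → ∃ λ v → adj H u v ≡ true) →
    IsGM (Lex T H) g → IsTreewidth H t →
    g ^ (2 ^ r) ≤ 5 ^ (2 ^ r) * n H ^ (2 ^ r ∸ 1) * t
theorem13 T H r g t tree ((centre , near) , _) simpleH edgeH@(u , _) (minor , _) (δ , _) =
  Product.gm-bound T H (IsTree.simple tree) (BreadthFirst.rooted tree centre near)
    (minor-model minor) δ (≤-trans (s≤s z≤n) (toℕ<n u)) (width-positive simpleH edgeH δ)
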